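{- Trees on $n$ vertices with distinct chromatic symmetric functions form an antichain in $\mathcal{E}_n$; that is, if $T_1$ and $T_2$ are trees on $n$ vertices with $X_{T_1}\neq X_{T_2}$, then neither $T_1\geq_e T_2$ nor $T_2\geq_e T_1$.
   Context: All graphs are finite and simple. The chromatic symmetric function of a graph $G$ with vertices $v_1,\dots,v_n$ is $X_G=\sum_{\kappa}x_{\kappa(v_1)}\cdots x_{\kappa(v_n)}$, summed over all proper colorings $\kappa:V(G)\to\{1,2,3,\dots\}$; it is a homogeneous symmetric function of degree $n$ over $\mathbb{Q}$. Let $e_\lambda=e_{\lambda_1}e_{\lambda_2}\cdots$ be the elementary symmetric functions; $[e_\lambda]F$ denotes the coefficient of $e_\lambda$ in $F$ expanded in this basis, and $F$ is $e$-positive if $[e_\lambda]F\ge 0$ for all $\lambda$. For connected graphs $G,H$ on $n$ vertices (for which $[e_{(n)}]X_G$ and $[e_{(n)}]X_H$ are positive), set $$X_e(G,H)=X_G-\frac{[e_{(n)}]X_G}{[e_{(n)}]X_H}X_H.$$ $\mathcal{E}_n$ is the poset whose elements are the equivalence classes of connected graphs on $n$ vertices under $G\sim H\iff X_G=X_H$, ordered by $G\geq_e H$ if and only if $X_e(G,H)$ is $e$-positive. -}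

module Defs where

open import Data.Nat as ℕ using (ℕ; zero; suc)
open import Data.Fin as Fin using (Fin; zero; suc; fromℕ; inject₁)
import Data.Fin.Properties as Fin
open import Data.Integer using (+_)
open import Data.Rational using (ℚ; 0ℚ; 1ℚ; _+_; _*_; _-_; _÷_; _/_; _≤_; ≢-nonZero)
import Data.Rational.Properties as ℚ
open import Data.List as List using (List; []; _∷_)
open import Data.List.Relation.Unary.All using (All)
open import Data.List.Relation.Unary.Linked using (linked?)
open import Data.Vec as Vec using (Vec; []; _∷_; lookup; tabulate; count)
import Data.Vec.Properties as Vec
open import Data.Vec.Relation.Unary.All as VecAll using ()
open import Data.Product using (Σ-syntax; _×_; _,_)
open import Function.Definitions using (Injective)
open import Relation.Binary.Core using (Rel)
open import Relation.Binary.Definitions using (Symmetric; Decidable)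
open import Relation.Binary.Construct.Closure.ReflexiveTransitive using (Star)
open import Relation.Binary.PropositionalEquality using (_≡_; _≢_)
open import Relation.Nullary using (¬_; Dec; yes; no; ¬?; does)
open import Relation.Nullary.Decidable using (_×-dec_; _→-dec_)
open import Data.Bool using (if_then_else_)
open import Level using (0ℓ)

------------------------------------------------------------------------
-- Graphs

record Graph (n : ℕ) : Set₁ where
  field
    Adj   : Rel (Fin n) 0ℓ
    adj?  : Decidable Adj
    sym   : Symmetric Adj
    irrefl : ∀ v → ¬ Adj v v

open Graph public

-- The field `vertex` excludes the graph with no vertices.
record Connected {n} (G : Graph n) : Set where
  field
    vertex : Fin n
    walk   : ∀ u v → Star (Adj G) u v

-- A cycle on the 3 + m distinct vertices c 0, …, c (2 + m).
record Cycle {n} (G : Graph n) : Set where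
  field
    {m}      : ℕ
    c        : Fin (3 ℕ.+ m) → Fin n
    distinct : Injective _≡_ _≡_ c
    step     : ∀ i → Adj G (c (inject₁ i)) (c (suc i))
    close    : Adj G (c (fromℕ (2 ℕ.+ m))) (c zero)

Acyclic : ∀ {n} → Graph n → Set
Acyclic G = ¬ Cycle G

IsTree : ∀ {n} → Graph n → Set
IsTree G = Connected G × Acyclic G

------------------------------------------------------------------------
-- Formal power series over ℚ in the variables x₁, x₂, …

-- A series is given by its coefficients: F k α is the coefficient of
-- x₁^α₁ ⋯ x_k^α_k in F.  A monomial is thus named by every k beyond its last
-- variable; all the series built below agree on these names.
Series : Set
Series = (k : ℕ) → Vec ℕ k → ℚ

infix 4 _≈_
_≈_ : Rel Series 0ℓ
F ≈ G = ∀ k (α : Vec ℕ k) → F k α ≡ G k α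

∑ : List ℚ → ℚ
∑ = List.foldr _+_ 0ℚ

infixl 6 _⊖_
_⊖_ : Series → Series → Series
(F ⊖ G) k α = F k α - G k α

infixr 7 _•_
_•_ : ℚ → Series → Series
(q • F) k α = q * F k α

-- All pairs (β , γ) of exponent vectors with β + γ = α.
splits : ∀ {k} → Vec ℕ k → List (Vec ℕ k × Vec ℕ k)
splits []      = ([] , []) ∷ []
splits (a ∷ α) = List.cartesianProductWith
  (λ { i (β , γ) → (i ∷ β) , ((a ℕ.∸ i) ∷ γ) }) (List.upTo (suc a)) (splits α)

infixl 7 _⊗_
_⊗_ : Series → Series → Series
(F ⊗ G) k α = ∑ (List.map (λ { (β , γ) → F k β * G k γ }) (splits α))

------------------------------------------------------------------------
-- Elementary symmetric functions

-- e r is the sum of all squarefree monomials of degree r; in particular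
-- e 0 is the constant series 1.
e : ℕ → Series
e r k α = if does (VecAll.all? (ℕ._≤? 1) α ×-dec (Vec.sum α ℕ.≟ r)) then 1ℚ else 0ℚ

e[_] : List ℕ → Series
e[ lam ] = List.foldr (λ r F → e r ⊗ F) (e 0) lam

-- All lists of positive integers with sum n, each listed once.
compositions : ℕ → List (List ℕ)
compositions zero    = [] ∷ []
compositions (suc n) = List.concatMap extend (compositions n)
  where
  extend : List ℕ → List (List ℕ)
  extend []      = (1 ∷ []) ∷ []
  extend (a ∷ c) = (1 ∷ a ∷ c) ∷ (suc a ∷ c) ∷ []

-- The partitions of n, as weakly decreasing lists.
partitions : ℕ → List (List ℕ)
partitions n = List.filter (linked? ℕ._≥?_) (compositions n)

-- The expansion of F, homogeneous of degree n, in the basis (e_λ), λ ⊢ n: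
-- `coeff lam` is [e_λ]F.  Only the values of `coeff` at partitions of n are
-- meaningful; as the e_λ form a basis of the symmetric functions, these exist
-- and are unique whenever F is symmetric and homogeneous of degree n.
record EExpansion (n : ℕ) (F : Series) : Set where
  field
    coeff   : List ℕ → ℚ
    expands : F ≈ λ k α → ∑ (List.map (λ lam → coeff lam * e[ lam ] k α) (partitions n))

open EExpansion public

EPositive : ℕ → Series → Set
EPositive n F = Σ[ E ∈ EExpansion n F ] All (λ lam → 0ℚ ≤ coeff E lam) (partitions n)

------------------------------------------------------------------------
-- Chromatic symmetric functions

module _ {n : ℕ} (G : Graph n) where

  Proper : ∀ {k} → Vec (Fin k) n → Set
  Proper κ = ∀ u v → Adj G u v → lookup κ u ≢ lookup κ v

  proper? : ∀ {k} (κ : Vec (Fin k) n) → Dec (Proper κ)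
  proper? κ = Fin.all? λ u → Fin.all? λ v →
    adj? G u v →-dec ¬? (lookup κ u Fin.≟ lookup κ v)

-- The exponent vector of x_{κ(v₁)} ⋯ x_{κ(vₙ)}.
content : ∀ {n k} → Vec (Fin k) n → Vec ℕ k
content κ = tabulate λ i → count (i Fin.≟_) κ

colorings : ∀ n k → List (Vec (Fin k) n)
colorings zero    k = [] ∷ []
colorings (suc n) k = List.cartesianProductWith _∷_ (List.allFin k) (colorings n k)

-- A coloring contributing to x₁^α₁ ⋯ x_k^α_k uses only the first k colors, so
-- the coefficient of this monomial counts the proper k-colorings of content α.
X : ∀ {n} → Graph n → Series
X {n} G k α = + List.length (List.filter
  (λ κ → proper? G κ ×-dec Vec.≡-dec ℕ._≟_ (content κ) α) (colorings n k)) / 1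

------------------------------------------------------------------------
-- The poset of connected graphs on n vertices

-- Elements are represented by connected graphs, with `_∼_` as equality.
record 𝓔 (n : ℕ) : Set₁ where
  field
    graph     : Graph n
    connected : Connected graph

open 𝓔 public

infix 4 _∼_ _≥ₑ_

_∼_ : ∀ {n} → Rel (𝓔 n) 0ℓ
G ∼ H = X (graph G) ≈ X (graph H)

-- Division, made total by p ÷₀ 0 = 0.  The divisor below, [e_(n)]X_H, is
-- positive for connected H, so this value is never used.
infixl 7 _÷₀_
_÷₀_ : ℚ → ℚ → ℚ
p ÷₀ q with q ℚ.≟ 0ℚ
... | yes _  = 0ℚ
... | no q≢0 = (p ÷ q) {{≢-nonZero q≢0}}

Xₑ : ∀ {n} (G H : Graph n) → EExpansion n (X G) → EExpansion n (X H) → Series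
Xₑ {n} G H EG EH = X G ⊖ (coeff EG (n ∷ []) ÷₀ coeff EH (n ∷ [])) • X H

-- The expansions of X_G and X_H that are quantified over exist and are unique.
_≥ₑ_ : ∀ {n} → Rel (𝓔 n) 0ℓ
_≥ₑ_ {n} G H =
  Σ[ EG ∈ EExpansion n (X (graph G)) ] Σ[ EH ∈ EExpansion n (X (graph H)) ]
    EPositive n (Xₑ (graph G) (graph H) EG EH)

{-# OPTIONS --safe #-}
module Submission where

-- Specialising x₁ = ⋯ = x_k = 1 turns e_λ into C(k , λ) = ∏ᵢ C(k , λᵢ) and X_T into
-- k (k - 1)ⁿ⁻¹ for every tree T on n vertices.  As a polynomial in k, C(k , λ) is
-- divisible by k², except for λ = (n); comparing linear terms shows that [e_(n)]X_T is
-- nonzero and the same for all T.  So Xₑ(T₁ , T₂) = X_{T₁} - X_{T₂}, which specialises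
-- to 0.  At k = n all C(k , λ) are positive, so an e-positive series that specialises
-- to 0 is 0.

open import Defs hiding (sym)
open import Data.Nat as ℕ using (ℕ; zero; suc; _∸_)
import Data.Nat.Properties as ℕ
open import Data.Bool as Bool using (true; false; if_then_else_)
open import Data.Fin as Fin using (Fin; zero; suc; fromℕ; inject₁; opposite)
import Data.Fin.Properties as Fin
open import Data.Fin.Subset using (Subset; ∣_∣)
import Data.Fin.Subset.Properties as Subset
import Data.Integer as ℤ
import Data.Integer.Properties as ℤ
open import Data.Rational using (ℚ; 0ℚ; 1ℚ; _+_; _*_; _-_; -_; 1/_; _≤_; _<_; _/_;
  toℚᵘ; ≢-nonZero; positive; nonNegative)
import Data.Rational.Properties as ℚ
open import Data.Rational.Solver using (module +-*-Solver)
open +-*-Solver using (solve; _:+_; _:*_; _:-_; _:=_; con)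
import Data.Rational.Unnormalised as ℚᵘ
import Data.Rational.Unnormalised.Properties as ℚᵘ
open import Data.List as List using (List; []; _∷_; _++_; map; foldr; applyUpTo; upTo;
  allFin; cartesianProductWith; filter; length)
import Data.List.Properties as List
open import Data.Nat.ListAction using (sum)
open import Data.List.Membership.Propositional using (_∈_; find)
open import Data.List.Membership.Propositional.Properties using (∈-concatMap⁻; ∈-filter⁻)
open import Data.List.Relation.Unary.Any using (here; there)
import Data.List.Relation.Unary.All as All
open import Data.List.Relation.Unary.Linked using (linked?)
open import Data.Sum using (_⊎_; inj₁; inj₂)
open import Data.Vec as Vec using (Vec; []; _∷_; lookup; replicate; _[_]≔_)
import Data.Vec.Properties as Vec
import Data.Vec.Relation.Unary.All as VecAll
open import Data.Product using (Σ-syntax; ∃-syntax; _×_; _,_; proj₁; proj₂)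
open import Relation.Binary.PropositionalEquality
  using (_≡_; _≢_; refl; sym; trans; cong; cong₂; subst; module ≡-Reasoning)
open import Function using (_∘_; id; _⇔_; mk⇔)
open import Function.Definitions using (Injective)
open import Relation.Binary.Construct.Closure.ReflexiveTransitive using (Star; ε; _◅_)
open import Relation.Nullary using (¬_; Dec; yes; no; does; ¬?; contradiction)
open import Relation.Nullary.Decidable using (_×-dec_; _→-dec_; does-⇔; dec-true)

private variable
  A B : Set
  k n : ℕ

-- The obstacle is that `_≥ₑ_` brings its own expansions, whose coefficients have to be read off
-- from one number per k. The linear term isolates [e_(n)], but it sits at k = 0, where both sides
-- vanish, while the tree count is available for k ≥ 1. So both sides are divided by k as polynomial
-- functions, and the equality of the quotients for k ≥ 1 is carried to k = 0. There k (k - 1)ⁿ⁻¹ /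
-- k takes the value (-1)ⁿ⁻¹, which is why [e_(n)]X_T cannot vanish. The tree count comes from
-- growing a vertex set inside the fixed graph along its edges. Acyclicity gives each new vertex
-- exactly one neighbour in the set, hence exactly one forbidden color.

ι : ℕ → ℚ
ι zero    = 0ℚ
ι (suc m) = 1ℚ + ι m

-- `X` counts colorings by `+ m / 1`, which normalises through a gcd and does not unfold at a
-- successor, as `ι` does. In unnormalised rationals the step is integer arithmetic.
/1≡ι : ∀ m → ℤ.+ m / 1 ≡ ι m
/1≡ι zero    = refl
/1≡ι (suc m) = trans (ℚ.toℚᵘ-injective (begin
  toℚᵘ (ℤ.+ suc m / 1)                    ≈⟨ ℚ.toℚᵘ-fromℚᵘ (ℤ.+ suc m ℚᵘ./ 1) ⟩
  ℤ.+ suc m ℚᵘ./ 1                        ≈⟨ ℚᵘ.*≡* (cong (λ z → (ℤ.+ 1 ℤ.+ z) ℤ.* ℤ.+ 1) (sym (ℤ.*-identityʳ (ℤ.+ m)))) ⟩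
  ℚᵘ.1ℚᵘ ℚᵘ.+ (ℤ.+ m ℚᵘ./ 1)              ≈⟨ ℚᵘ.+-congʳ ℚᵘ.1ℚᵘ (ℚᵘ.≃-sym (ℚ.toℚᵘ-fromℚᵘ (ℤ.+ m ℚᵘ./ 1))) ⟩
  ℚᵘ.1ℚᵘ ℚᵘ.+ toℚᵘ (ℤ.+ m / 1)            ≈⟨ ℚᵘ.≃-sym (ℚ.toℚᵘ-homo-+ 1ℚ (ℤ.+ m / 1)) ⟩
  toℚᵘ (1ℚ + (ℤ.+ m / 1))                 ∎)) (cong (1ℚ +_) (/1≡ι m))
  where open ℚᵘ.≃-Reasoning

ι-nonneg : ∀ m → 0ℚ ≤ ι m
ι-nonneg zero    = ℚ.≤-refl
ι-nonneg (suc m) = ℚ.+-mono-≤ (ℚ.nonNegative⁻¹ 1ℚ) (ι-nonneg m)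

ι-pos : ∀ m → 0ℚ < ι (suc m)
ι-pos m = ℚ.+-mono-<-≤ (ℚ.positive⁻¹ 1ℚ) (ι-nonneg m)

0<⇒≢0 : ∀ {p} → 0ℚ < p → p ≢ 0ℚ
0<⇒≢0 0<p p≡0 = ℚ.<-irrefl (sym p≡0) 0<p

*-cancelˡ : ∀ {p} → p ≢ 0ℚ → ∀ {q r} → p * q ≡ p * r → q ≡ r
*-cancelˡ {p} p≢0 {q} {r} eq = begin
  q                ≡⟨ undo q ⟨
  1/ p * (p * q)   ≡⟨ cong (1/ p *_) eq ⟩
  1/ p * (p * r)   ≡⟨ undo r ⟩
  r                ∎
  where
  open ≡-Reasoning
  instance _ = ≢-nonZero p≢0
  undo : ∀ x → 1/ p * (p * x) ≡ x
  undo x = trans (sym (ℚ.*-assoc (1/ p) p x)) (trans (cong (_* x) (ℚ.*-inverseˡ p)) (ℚ.*-identityˡ x))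

-- Sums over lists

sumOver : List A → (A → ℚ) → ℚ
sumOver xs f = ∑ (map f xs)

𝟙 : {P : Set} → Dec P → ℚ
𝟙 P? = if does P? then 1ℚ else 0ℚ

sumOver-cong : ∀ (xs : List A) {f g : A → ℚ} → (∀ x → f x ≡ g x) → sumOver xs f ≡ sumOver xs g
sumOver-cong xs f≗g = cong ∑ (List.map-cong f≗g xs)

sumOver-0 : ∀ (xs : List A) → sumOver xs (λ _ → 0ℚ) ≡ 0ℚ
sumOver-0 []       = refl
sumOver-0 (x ∷ xs) = trans (ℚ.+-identityˡ _) (sumOver-0 xs)

sumOver-+ : ∀ (xs : List A) (f g : A → ℚ) →
  sumOver xs (λ x → f x + g x) ≡ sumOver xs f + sumOver xs g
sumOver-+ []       f g = refl
sumOver-+ (x ∷ xs) f g = trans (cong (f x + g x +_) (sumOver-+ xs f g))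
  (solve 4 (λ a b c d → a :+ b :+ (c :+ d) := a :+ c :+ (b :+ d)) refl (f x) (g x) _ _)

sumOver-*ˡ : ∀ (xs : List A) q (f : A → ℚ) → sumOver xs (λ x → q * f x) ≡ q * sumOver xs f
sumOver-*ˡ []       q f = sym (ℚ.*-zeroʳ q)
sumOver-*ˡ (x ∷ xs) q f = trans (cong (q * f x +_) (sumOver-*ˡ xs q f)) (sym (ℚ.*-distribˡ-+ q _ _))

sumOver-*ʳ : ∀ (xs : List A) q (f : A → ℚ) → sumOver xs (λ x → f x * q) ≡ sumOver xs f * q
sumOver-*ʳ xs q f = trans (sumOver-cong xs (λ x → ℚ.*-comm (f x) q))
  (trans (sumOver-*ˡ xs q f) (ℚ.*-comm q _))

sumOver-swap : ∀ (xs : List A) (ys : List B) (f : A → B → ℚ) →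
  sumOver xs (λ x → sumOver ys (f x)) ≡ sumOver ys (λ y → sumOver xs (λ x → f x y))
sumOver-swap []       ys f = sym (sumOver-0 ys)
sumOver-swap (x ∷ xs) ys f = trans (cong (sumOver ys (f x) +_) (sumOver-swap xs ys f))
  (sym (sumOver-+ ys (f x) (λ y → sumOver xs (λ x → f x y))))

sumOver-++ : ∀ (xs ys : List A) (f : A → ℚ) → sumOver (xs ++ ys) f ≡ sumOver xs f + sumOver ys f
sumOver-++ []       ys f = sym (ℚ.+-identityˡ _)
sumOver-++ (x ∷ xs) ys f = trans (cong (f x +_) (sumOver-++ xs ys f)) (sym (ℚ.+-assoc (f x) _ _))

sumOver-map : ∀ (g : A → B) (xs : List A) (f : B → ℚ) → sumOver (map g xs) f ≡ sumOver xs (f ∘ g)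
sumOver-map g xs f = cong ∑ (sym (List.map-∘ xs))

sumOver-cartesianProductWith : ∀ {C : Set} (_∙_ : A → B → C) xs ys (f : C → ℚ) →
  sumOver (cartesianProductWith _∙_ xs ys) f ≡ sumOver xs (λ x → sumOver ys (λ y → f (x ∙ y)))
sumOver-cartesianProductWith _∙_ []       ys f = refl
sumOver-cartesianProductWith _∙_ (x ∷ xs) ys f = trans (sumOver-++ (map (x ∙_) ys) _ f)
  (cong₂ _+_ (sumOver-map (x ∙_) ys f) (sumOver-cartesianProductWith _∙_ xs ys f))

length-filter : ∀ {P : A → Set} (P? : ∀ x → Dec (P x)) xs →
  ℤ.+ length (filter P? xs) / 1 ≡ sumOver xs (λ x → 𝟙 (P? x))
length-filter P? xs = trans (/1≡ι (length (filter P? xs))) (go xs)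
  where
  go : ∀ xs → ι (length (filter P? xs)) ≡ sumOver xs (λ x → 𝟙 (P? x))
  go []       = refl
  go (x ∷ xs) with does (P? x)
  ... | true  = cong (1ℚ +_) (go xs)
  ... | false = trans (go xs) (sym (ℚ.+-identityˡ _))

-- Total coefficient sums

-- f has finitely many nonzero terms, and their sum is s.
data Sums (f : ℕ → ℚ) (s : ℚ) : Set where
  stop : (∀ i → f i ≡ 0ℚ) → s ≡ 0ℚ → Sums f s
  next : ∀ {t} → Sums (f ∘ suc) t → s ≡ f 0 + t → Sums f s

Sums-null : ∀ {f s} → (∀ i → f i ≡ 0ℚ) → Sums f s → s ≡ 0ℚ
Sums-null f≗0 (stop _ s≡0)  = s≡0
Sums-null f≗0 (next F refl) = cong₂ _+_ (f≗0 0) (Sums-null (f≗0 ∘ suc) F)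

-- Two witnesses may stop at different indices; where one stops, the other sums a zero tail.
Sums-unique : ∀ {f g s t} → (∀ i → f i ≡ g i) → Sums f s → Sums g t → s ≡ t
Sums-unique f≗g (stop f≗0 refl) G = sym (Sums-null (λ i → trans (sym (f≗g i)) (f≗0 i)) G)
Sums-unique f≗g F@(next _ _) (stop g≗0 refl) = Sums-null (λ i → trans (f≗g i) (g≗0 i)) F
Sums-unique f≗g (next F refl) (next G refl)  = cong₂ _+_ (f≗g 0) (Sums-unique (f≗g ∘ suc) F G)

Sums-cong : ∀ {f g s} → (∀ i → f i ≡ g i) → Sums f s → Sums g s
Sums-cong f≗g (stop f≗0 s≡0) = stop (λ i → trans (sym (f≗g i)) (f≗0 i)) s≡0
Sums-cong f≗g (next F s≡)    = next (Sums-cong (f≗g ∘ suc) F) (trans s≡ (cong (_+ _) (f≗g 0)))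

Sums-0 : Sums (λ _ → 0ℚ) 0ℚ
Sums-0 = stop (λ _ → refl) refl

Sums-+ : ∀ {f g s t} → Sums f s → Sums g t → Sums (λ i → f i + g i) (s + t)
Sums-+ {g = g} (stop f≗0 refl) G =
  subst (Sums _) (sym (ℚ.+-identityˡ _)) (Sums-cong (λ i → trans (sym (ℚ.+-identityˡ (g i))) (cong (_+ g i) (sym (f≗0 i)))) G)
Sums-+ {f} F@(next _ _) (stop g≗0 refl) =
  subst (Sums _) (sym (ℚ.+-identityʳ _)) (Sums-cong (λ i → trans (sym (ℚ.+-identityʳ (f i))) (cong (f i +_) (sym (g≗0 i)))) F)
Sums-+ {f} {g} (next {t = s} F refl) (next {t = t} G refl) = next (Sums-+ F G)
  (solve 4 (λ a b c d → a :+ c :+ (b :+ d) := a :+ b :+ (c :+ d)) refl (f 0) (g 0) s t)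

Sums-*ˡ : ∀ q {f s} → Sums f s → Sums (λ i → q * f i) (q * s)
Sums-*ˡ q (stop f≗0 refl) = stop (λ i → trans (cong (q *_) (f≗0 i)) (ℚ.*-zeroʳ q)) (ℚ.*-zeroʳ q)
Sums-*ˡ q (next F refl)   = next (Sums-*ˡ q F) (ℚ.*-distribˡ-+ q _ _)

cauchy : (ℕ → ℚ) → (ℕ → ℚ) → ℕ → ℚ
cauchy f g a = ∑ (applyUpTo (λ i → f i * g (a ∸ i)) (suc a))

∑-applyUpTo-0 : ∀ {f} n → (∀ i → f i ≡ 0ℚ) → ∑ (applyUpTo f n) ≡ 0ℚ
∑-applyUpTo-0 zero    f≗0 = refl
∑-applyUpTo-0 (suc n) f≗0 = cong₂ _+_ (f≗0 0) (∑-applyUpTo-0 n (f≗0 ∘ suc))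

-- As generating functions, f is f 0 plus x times its tail, so the product is f 0 times g plus x
-- times (tail times g). Multiplication by x is `delayed`.
Sums-cauchy : ∀ {f g s t} → Sums f s → Sums g t → Sums (cauchy f g) (s * t)
Sums-cauchy {f} {g} {t = t} (stop f≗0 refl) G = stop
  (λ a → ∑-applyUpTo-0 (suc a) (λ i → trans (cong (_* g (a ∸ i)) (f≗0 i)) (ℚ.*-zeroˡ (g (a ∸ i))))) (ℚ.*-zeroˡ t)
Sums-cauchy {f} {g} {t = t} (next {t = s} F refl) G =
  Sums-cong unfold (subst (Sums _) (sym (ℚ.*-distribʳ-+ t (f 0) s)) (Sums-+ (Sums-*ˡ (f 0) G) shifted))
  where
  delayed : ℕ → ℚ
  delayed zero    = 0ℚ
  delayed (suc a) = cauchy (f ∘ suc) g a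
  shifted : Sums delayed (s * t)
  shifted = next (Sums-cauchy F G) (sym (ℚ.+-identityˡ _))
  unfold : ∀ a → f 0 * g a + delayed a ≡ cauchy f g a
  unfold zero    = refl
  unfold (suc a) = refl

-- HasTotal k f s: the coefficients f of a polynomial in k variables add up to s,
-- its value at x₁ = ⋯ = x_k = 1.
HasTotal : ∀ k → (Vec ℕ k → ℚ) → ℚ → Set
HasTotal zero    f s = f [] ≡ s
HasTotal (suc k) f s = Σ[ g ∈ (ℕ → ℚ) ] (∀ i → HasTotal k (λ α → f (i ∷ α)) (g i)) × Sums g s

-- Totals form a relation, since a sum over all exponent vectors cannot be computed. Identities
-- between values arise here, from two evaluations of one series.
total-unique : ∀ k {f g s t} → (∀ α → f α ≡ g α) → HasTotal k f s → HasTotal k g t → s ≡ t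
total-unique zero    f≗g F G = trans (sym F) (trans (f≗g []) G)
total-unique (suc k) f≗g (_ , F , S) (_ , G , T) =
  Sums-unique (λ i → total-unique k (λ α → f≗g (i ∷ α)) (F i) (G i)) S T

total-cong : ∀ k {f g s} → (∀ α → f α ≡ g α) → HasTotal k f s → HasTotal k g s
total-cong zero    f≗g F           = trans (sym (f≗g [])) F
total-cong (suc k) f≗g (u , F , S) = u , (λ i → total-cong k (λ α → f≗g (i ∷ α)) (F i)) , S

total-0 : ∀ k → HasTotal k (λ _ → 0ℚ) 0ℚ
total-0 zero    = refl
total-0 (suc k) = (λ _ → 0ℚ) , (λ _ → total-0 k) , Sums-0

total-+ : ∀ k {f g s t} → HasTotal k f s → HasTotal k g t → HasTotal k (λ α → f α + g α) (s + t)
total-+ zero    F G = cong₂ _+_ F G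
total-+ (suc k) (u , F , S) (v , G , T) =
  (λ i → u i + v i) , (λ i → total-+ k (F i) (G i)) , Sums-+ S T

total-*ˡ : ∀ k q {f s} → HasTotal k f s → HasTotal k (λ α → q * f α) (q * s)
total-*ˡ zero    q F           = cong (q *_) F
total-*ˡ (suc k) q (u , F , S) = (λ i → q * u i) , (λ i → total-*ˡ k q (F i)) , Sums-*ˡ q S

total-sumOver : ∀ k (xs : List A) {f : A → Vec ℕ k → ℚ} {s : A → ℚ} → (∀ x → HasTotal k (f x) (s x)) →
  HasTotal k (λ α → sumOver xs (λ x → f x α)) (sumOver xs s)
total-sumOver k []       F = total-0 k
total-sumOver k (x ∷ xs) F = total-+ k (F x) (total-sumOver k xs F)

total-upTo : ∀ k n {f : ℕ → Vec ℕ k → ℚ} {s : ℕ → ℚ} → (∀ i → HasTotal k (f i) (s i)) →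
  HasTotal k (λ α → ∑ (applyUpTo (λ i → f i α) n)) (∑ (applyUpTo s n))
total-upTo k zero    F = total-0 k
total-upTo k (suc n) F = total-+ k (F 0) (total-upTo k n (F ∘ suc))

-- The product `_⊗_` at a fixed number of variables, so that it also applies to slices, which are
-- not of type `Series`.
_⊛_ : (Vec ℕ k → ℚ) → (Vec ℕ k → ℚ) → Vec ℕ k → ℚ
(f ⊛ g) α = sumOver (splits α) (λ βγ → f (proj₁ βγ) * g (proj₂ βγ))

-- `splits (a ∷ α)` runs over a first exponent i and then over `splits α`, so the slice of the
-- product at a is a sum of products of slices, and its total is a term of a Cauchy product.
total-⊛ : ∀ k {f g s t} → HasTotal k f s → HasTotal k g t → HasTotal k (f ⊛ g) (s * t)
total-⊛ zero    F G = trans (ℚ.+-identityʳ _) (cong₂ _*_ F G)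
total-⊛ (suc k) {f} {g} (u , F , S) (v , G , T) = cauchy u v , slice , Sums-cauchy S T
  where
  convolve : ∀ a → Vec ℕ k → ℕ → ℚ
  convolve a α i = ((f ∘ (i ∷_)) ⊛ (g ∘ ((a ∸ i) ∷_))) α
  unfold : ∀ a α → ∑ (applyUpTo (convolve a α) (suc a)) ≡ (f ⊛ g) (a ∷ α)
  unfold a α = sym (trans (sumOver-cartesianProductWith _ (upTo (suc a)) (splits α) (λ βγ → f (proj₁ βγ) * g (proj₂ βγ)))
    (cong ∑ (List.map-upTo (convolve a α) (suc a))))
  slice : ∀ a → HasTotal k (λ α → (f ⊛ g) (a ∷ α)) (cauchy u v a)
  slice a = total-cong k (unfold a) (total-upTo k (suc a) (λ i → total-⊛ k (F i) (G (a ∸ i))))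

total-⊗ : ∀ k (F G : Series) {s t} → HasTotal k (F k) s → HasTotal k (G k) t → HasTotal k ((F ⊗ G) k) (s * t)
total-⊗ k F G f g = total-cong k (λ α → sumOver-cong (splits α) (λ { (β , γ) → refl })) (total-⊛ k f g)

total-singleton : ∀ k (α : Vec ℕ k) → HasTotal k (λ β → 𝟙 (Vec.≡-dec ℕ._≟_ α β)) 1ℚ
total-singleton zero    []      = refl
total-singleton (suc k) (a ∷ α) = (λ i → 𝟙 (a ℕ.≟ i)) , slice , point a
  where
  slice : ∀ i → HasTotal k (λ β → 𝟙 (Vec.≡-dec ℕ._≟_ (a ∷ α) (i ∷ β))) (𝟙 (a ℕ.≟ i))
  -- `does (a ℕ.≟ i)` computes to this Boolean, so abstracting it reduces both the slice and its
  -- claimed total.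
  slice i with a ℕ.≡ᵇ i
  ... | true  = total-singleton k α
  ... | false = total-0 k
  point : ∀ a → Sums (λ i → 𝟙 (a ℕ.≟ i)) 1ℚ
  point zero    = next Sums-0 refl
  point (suc a) = next (point a) refl

-- Binomial coefficients and polynomials

C : ℕ → ℕ → ℚ
C k       zero    = 1ℚ
C zero    (suc r) = 0ℚ
C (suc k) (suc r) = C k r + C k (suc r)

-- Sort the monomials by the exponent of the first variable: 0 leaves degree r, 1 leaves degree r -
-- 1, and larger exponents are not squarefree. This is Pascal's rule.
total-e : ∀ k r → HasTotal k (e r k) (C k r)
total-e zero    zero    = refl
total-e zero    (suc r) = refl
total-e (suc k) zero    = _ , slice , next (stop (λ _ → refl) refl) refl
  where
  u : ℕ → ℚ
  u zero    = C k 0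
  u (suc i) = 0ℚ
  slice : ∀ i → HasTotal k (λ α → e 0 (suc k) (i ∷ α)) (u i)
  slice zero          = total-e k 0
  slice (suc zero)    = total-cong k vanish (total-0 k)
    where
    vanish : ∀ α → 0ℚ ≡ e 0 (suc k) (1 ∷ α)
    -- The degree test fails, but it is the second conjunct; the first must be decided before the
    -- conjunction computes.
    vanish α with does (VecAll.all? (ℕ._≤? 1) α)
    ... | true  = refl
    ... | false = refl
  slice (suc (suc i)) = total-0 k
total-e (suc k) (suc r) = _ , slice , next (next Sums-0 refl) (trans (ℚ.+-comm (C k r) _) (cong (C k (suc r) +_) (sym (ℚ.+-identityʳ _))))
  where
  u : ℕ → ℚ
  u zero          = C k (suc r)
  u (suc zero)    = C k r
  u (suc (suc i)) = 0ℚ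
  slice : ∀ i → HasTotal k (λ α → e (suc r) (suc k) (i ∷ α)) (u i)
  slice zero          = total-e k (suc r)
  slice (suc zero)    = total-e k r
  slice (suc (suc i)) = total-0 k

Cs : List ℕ → ℕ → ℚ
Cs lam k = foldr (λ r q → C k r * q) 1ℚ lam

total-e[] : ∀ k lam → HasTotal k (e[ lam ] k) (Cs lam k)
total-e[] k []        = total-e k 0
total-e[] k (r ∷ lam) = total-⊗ k (e r) e[ lam ] (total-e k r) (total-e[] k lam)

C-nonneg : ∀ k r → 0ℚ ≤ C k r
C-nonneg zero    zero    = ℚ.nonNegative⁻¹ 1ℚ
C-nonneg (suc k) zero    = ℚ.nonNegative⁻¹ 1ℚ
C-nonneg zero    (suc r) = ℚ.≤-refl
C-nonneg (suc k) (suc r) = ℚ.+-mono-≤ (C-nonneg k r) (C-nonneg k (suc r))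

C-pos : ∀ {k r} → r ℕ.≤ k → 0ℚ < C k r
C-pos {k} {zero}  _           = ℚ.positive⁻¹ 1ℚ
C-pos {suc k} {suc r} (ℕ.s≤s r≤k) = ℚ.+-mono-<-≤ (C-pos r≤k) (C-nonneg k (suc r))

*-pos : ∀ {p q} → 0ℚ < p → 0ℚ < q → 0ℚ < p * q
*-pos {p} {q} 0<p 0<q = ℚ.positive⁻¹ (p * q) {{ℚ.pos*pos⇒pos p {{positive 0<p}} q {{positive 0<q}}}}

*-nonneg : ∀ {p q} → 0ℚ ≤ p → 0ℚ ≤ q → 0ℚ ≤ p * q
*-nonneg {p} {q} 0≤p 0≤q =
  ℚ.nonNegative⁻¹ (p * q) {{ℚ.nonNeg*nonNeg⇒nonNeg p {{nonNegative 0≤p}} q {{nonNegative 0≤q}}}}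

Cs-pos : ∀ k lam → sum lam ℕ.≤ k → 0ℚ < Cs lam k
Cs-pos k []        _     = ℚ.positive⁻¹ 1ℚ
Cs-pos k (r ∷ lam) sum≤k = *-pos (C-pos (ℕ.≤-trans (ℕ.m≤m+n r _) sum≤k))
  (Cs-pos k lam (ℕ.≤-trans (ℕ.m≤n+m _ r) sum≤k))

-- Induction on k by Pascal's rule, with the hypothesis at r and at r + 1. For fixed r, this
-- recursion exhibits C(k , r) as a polynomial in k.
C-absorb : ∀ k r → ι (suc r) * C k (suc r) ≡ (ι k - ι r) * C k r
C-absorb zero    zero    = refl
C-absorb zero    (suc r) = trans (ℚ.*-zeroʳ (ι (suc (suc r)))) (sym (ℚ.*-zeroʳ (0ℚ - ι (suc r))))
C-absorb (suc k) zero    = begin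
  (1ℚ + 0ℚ) * (1ℚ + C k 1)   ≡⟨ solve 1 (λ c → con (1ℚ + 0ℚ) :* (con 1ℚ :+ c) := con 1ℚ :+ con (1ℚ + 0ℚ) :* c) refl (C k 1) ⟩
  1ℚ + (1ℚ + 0ℚ) * C k 1     ≡⟨ cong (1ℚ +_) (C-absorb k 0) ⟩
  1ℚ + (ι k - 0ℚ) * 1ℚ       ≡⟨ solve 1 (λ x → con 1ℚ :+ (x :- con 0ℚ) :* con 1ℚ := (con 1ℚ :+ x :- con 0ℚ) :* con 1ℚ) refl (ι k) ⟩
  (1ℚ + ι k - 0ℚ) * 1ℚ       ∎
  where open ≡-Reasoning
C-absorb (suc k) (suc r) = begin
  (1ℚ + (1ℚ + ρ)) * (b + c)                  ≡⟨ ℚ.*-distribˡ-+ (1ℚ + (1ℚ + ρ)) b c ⟩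
  (1ℚ + (1ℚ + ρ)) * b + (1ℚ + (1ℚ + ρ)) * c  ≡⟨ cong ((1ℚ + (1ℚ + ρ)) * b +_) (C-absorb k (suc r)) ⟩
  (1ℚ + (1ℚ + ρ)) * b + (κ - (1ℚ + ρ)) * b  
    ≡⟨ solve 3 (λ x y b → (con 1ℚ :+ (con 1ℚ :+ x)) :* b :+ (y :- (con 1ℚ :+ x)) :* b := (con 1ℚ :+ x) :* b :+ (y :- x) :* b) refl ρ κ b ⟩
  (1ℚ + ρ) * b + (κ - ρ) * b                 ≡⟨ cong (_+ (κ - ρ) * b) (C-absorb k r) ⟩
  (κ - ρ) * a + (κ - ρ) * b                 
    ≡⟨ solve 4 (λ x y a b → (y :- x) :* a :+ (y :- x) :* b := (con 1ℚ :+ y :- (con 1ℚ :+ x)) :* (a :+ b)) refl ρ κ a b ⟩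
  (1ℚ + κ - (1ℚ + ρ)) * (a + b)              ∎
  where
  open ≡-Reasoning
  κ = ι k
  ρ = ι r
  a = C k r
  b = C k (suc r)
  c = C k (suc (suc r))

Δ : (ℕ → ℚ) → ℕ → ℚ
Δ f k = f (suc k) - f k

-- f is a polynomial function of degree less than d: its d-th differences vanish.
DegreeBelow : ℕ → (ℕ → ℚ) → Set
DegreeBelow zero    f = ∀ k → f k ≡ 0ℚ
DegreeBelow (suc d) f = DegreeBelow d (Δ f)

-- The argument asks two things of polynomials: closure under ring operations, and that values at k
-- ≥ 1 determine the value at 0. Vanishing differences give both without handling coefficients.
Polynomial : (ℕ → ℚ) → Set
Polynomial f = ∃[ d ] DegreeBelow d f

degree-cong : ∀ d {f g} → (∀ k → f k ≡ g k) → DegreeBelow d f → DegreeBelow d g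
degree-cong zero    f≗g F k = trans (sym (f≗g k)) (F k)
degree-cong (suc d) f≗g F   = degree-cong d (λ k → cong₂ _-_ (f≗g (suc k)) (f≗g k)) F

degree-Δ : ∀ d {f} → DegreeBelow d f → DegreeBelow d (Δ f)
degree-Δ zero    F k = cong₂ _-_ (F (suc k)) (F k)
degree-Δ (suc d) F   = degree-Δ d F

degree-shift : ∀ d {f} → DegreeBelow d f → DegreeBelow d (f ∘ suc)
degree-shift zero    F k = F (suc k)
degree-shift (suc d) F   = degree-shift d F

-- The bound is cruder than the maximum: each step takes differences of both summands but lowers
-- only c, while `degree-Δ` keeps d.
degree-+ : ∀ c d {f g} → DegreeBelow c f → DegreeBelow d g → DegreeBelow (c ℕ.+ d) (λ k → f k + g k)
degree-+ zero    d {f} {g} F G =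
  degree-cong d (λ k → trans (sym (ℚ.+-identityˡ (g k))) (cong (_+ g k) (sym (F k)))) G
degree-+ (suc c) d {f} {g} F G = degree-cong (c ℕ.+ d)
  (λ k → solve 4 (λ a b x y → (a :- b) :+ (x :- y) := (a :+ x) :- (b :+ y)) refl (f (suc k)) (f k) (g (suc k)) (g k))
  (degree-+ c d F (degree-Δ d G))

poly-+ : ∀ {f g} → Polynomial f → Polynomial g → Polynomial (λ k → f k + g k)
poly-+ (c , F) (d , G) = c ℕ.+ d , degree-+ c d F G

poly-Δ : ∀ {f} → Polynomial (Δ f) → Polynomial f
poly-Δ (d , F) = suc d , F

poly-cong : ∀ {f g} → (∀ k → f k ≡ g k) → Polynomial f → Polynomial g
poly-cong f≗g (d , F) = d , degree-cong d f≗g F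

-- The discrete product rule writes Δ (f g) at k as Δ f k * g (k + 1) + f k * Δ g k. Each summand
-- lowers one of the two bounds and preserves the other.
poly-* : ∀ {f g} → Polynomial f → Polynomial g → Polynomial (λ k → f k * g k)
poly-* (c , F) (d , G) = go c d F G
  where
  go : ∀ c d {f g} → DegreeBelow c f → DegreeBelow d g → Polynomial (λ k → f k * g k)
  go zero    d       {f} {g} F G = 0 , λ k → trans (cong (_* g k) (F k)) (ℚ.*-zeroˡ (g k))
  go (suc c) zero    {f} {g} F G = 0 , λ k → trans (cong (f k *_) (G k)) (ℚ.*-zeroʳ (f k))
  go (suc c) (suc d) {f} {g} F G = poly-Δ (poly-cong
    (λ k → solve 4 (λ a b x y → (a :- b) :* x :+ b :* (x :- y) := a :* x :- b :* y) refl (f (suc k)) (f k) (g (suc k)) (g k))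
    (poly-+ (go c (suc d) {Δ f} {g ∘ suc} F (degree-shift (suc d) {g} G)) (go (suc c) d {f} {Δ g} F G)))

poly-const : ∀ q → Polynomial (λ _ → q)
poly-const q = 1 , λ _ → ℚ.+-inverseʳ q

poly-ι : Polynomial ι
poly-ι = poly-Δ (poly-cong (λ k → solve 1 (λ x → con 1ℚ := con 1ℚ :+ x :- x) refl (ι k)) (poly-const 1ℚ))

poly-minus : ∀ {f g} → Polynomial f → Polynomial g → Polynomial (λ k → f k - g k)
poly-minus {f} {g} F G = poly-cong (λ k → solve 2 (λ x y → x :+ con (- 1ℚ) :* y := x :- y) refl (f k) (g k))
  (poly-+ F (poly-* (poly-const (- 1ℚ)) G))

poly-sumOver : ∀ (xs : List A) {f : A → ℕ → ℚ} → (∀ x → Polynomial (f x)) → Polynomial (λ k → sumOver xs (λ x → f x k))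
poly-sumOver []       F = poly-const 0ℚ
poly-sumOver (x ∷ xs) F = poly-+ (F x) (poly-sumOver xs F)

-- f 0 = f 1 - Δ f 0, and Δ f again vanishes at all positive arguments, with a smaller bound.
poly-vanish : ∀ {f} → Polynomial f → (∀ k → f (suc k) ≡ 0ℚ) → f 0 ≡ 0ℚ
poly-vanish (d , F) = go d F
  where
  go : ∀ d {f} → DegreeBelow d f → (∀ k → f (suc k) ≡ 0ℚ) → f 0 ≡ 0ℚ
  go zero    F _ = F 0
  go (suc d) {f} F f≗0 = begin
    f 0                  ≡⟨ solve 2 (λ a b → b := a :- (a :- b)) refl (f 1) (f 0) ⟩
    f 1 - (f 1 - f 0)    ≡⟨ cong₂ _-_ (f≗0 0) (go d F (λ k → cong₂ _-_ (f≗0 (suc k)) (f≗0 k))) ⟩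
    0ℚ                   ∎
    where open ≡-Reasoning

-- The index is shifted to keep the divisor nonzero: `1/ι (suc r)` below is 1 / (r + 2).
1/ι : ℕ → ℚ
1/ι m = 1/_ (ι (suc m)) {{≢-nonZero (0<⇒≢0 (ι-pos m))}}

-- C(k , r + 1) / k, continued to k = 0 by the recursion of C-absorb.
C/k : ℕ → ℕ → ℚ
C/k zero    k = 1ℚ
C/k (suc r) k = 1/ι (suc r) * (ι k - ι (suc r)) * C/k r k

C/k-poly : ∀ r → Polynomial (C/k r)
C/k-poly zero    = poly-const 1ℚ
C/k-poly (suc r) = poly-* (poly-* (poly-const (1/ι (suc r))) (poly-minus poly-ι (poly-const (ι (suc r))))) (C/k-poly r)

-- The factor cancelled in the induction is r + 2, never k, so the factorisation is valid at k = 0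
-- as well.
C≡ι*C/k : ∀ r k → C k (suc r) ≡ ι k * C/k r k
C≡ι*C/k zero    k = begin
  C k 1             ≡⟨ solve 1 (λ c → c := con (ι 1) :* c) refl (C k 1) ⟩
  ι 1 * C k 1       ≡⟨ C-absorb k 0 ⟩
  (ι k - 0ℚ) * 1ℚ   ≡⟨ cong (_* 1ℚ) (ℚ.+-identityʳ (ι k)) ⟩
  ι k * 1ℚ          ∎
  where open ≡-Reasoning
C≡ι*C/k (suc r) k = *-cancelˡ ≢0 (begin
  ι (suc (suc r)) * C k (suc (suc r))       ≡⟨ C-absorb k (suc r) ⟩
  (ι k - ι (suc r)) * C k (suc r)           ≡⟨ cong ((ι k - ι (suc r)) *_) (C≡ι*C/k r k) ⟩
  (ι k - ι (suc r)) * (ι k * C/k r k)         ≡⟨ ℚ.*-identityˡ _ ⟨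
  1ℚ * ((ι k - ι (suc r)) * (ι k * C/k r k))
    ≡⟨ cong (_* ((ι k - ι (suc r)) * (ι k * C/k r k))) (ℚ.*-inverseʳ (ι (suc (suc r))) {{≢-nonZero ≢0}}) ⟨
  ι (suc (suc r)) * 1/ι (suc r) * ((ι k - ι (suc r)) * (ι k * C/k r k))
    ≡⟨ solve 5 (λ a i d x b → a :* i :* (d :* (x :* b)) := a :* (x :* (i :* d :* b))) refl
         (ι (suc (suc r))) (1/ι (suc r)) (ι k - ι (suc r)) (ι k) (C/k r k) ⟩
  ι (suc (suc r)) * (ι k * C/k (suc r) k)     ∎)
  where
  open ≡-Reasoning
  ≢0 : ι (suc (suc r)) ≢ 0ℚ
  ≢0 = 0<⇒≢0 (ι-pos (suc r))

C-poly : ∀ r → Polynomial (λ k → C k r)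
C-poly zero    = poly-const 1ℚ
C-poly (suc r) = poly-cong (λ k → sym (C≡ι*C/k r k)) (poly-* poly-ι (C/k-poly r))

Cs-poly : ∀ lam → Polynomial (Cs lam)
Cs-poly []        = poly-const 1ℚ
Cs-poly (r ∷ lam) = poly-* (C-poly r) (Cs-poly lam)

-- The polynomial Cs lam k / k; for lam empty or starting with 0 the value is junk.
Cs/k : List ℕ → ℕ → ℚ
Cs/k []            k = 0ℚ
Cs/k (zero  ∷ lam) k = 0ℚ
Cs/k (suc r ∷ lam) k = C/k r k * Cs lam k

Cs/k-poly : ∀ lam → Polynomial (Cs/k lam)
Cs/k-poly []            = poly-const 0ℚ
Cs/k-poly (zero  ∷ lam) = poly-const 0ℚ
Cs/k-poly (suc r ∷ lam) = poly-* (C/k-poly r) (Cs-poly lam)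

-- Partitions

-- Matching on a proof turns every part into a successor, the form on which `Cs/k` computes.
data Positive : List ℕ → Set where
  []  : Positive []
  _∷_ : ∀ r {lam} → Positive lam → Positive (suc r ∷ lam)

compositions-spec : ∀ n {lam} → lam ∈ compositions n → Positive lam × sum lam ≡ n
compositions-spec zero    (here refl) = [] , refl
compositions-spec (suc n) lam∈ with find (∈-concatMap⁻ _ {xs = compositions n} lam∈)
... | []        , mu∈ , here refl         = 0 ∷ [] , cong suc (proj₂ (compositions-spec n mu∈))
... | (a ∷ mu)  , mu∈ , here refl         = 0 ∷ proj₁ (compositions-spec n mu∈) , cong suc (proj₂ (compositions-spec n mu∈))
... | (a ∷ mu)  , mu∈ , there (here refl) with compositions-spec n mu∈
... | r ∷ pos , eq = suc r ∷ pos , cong suc eq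

partitions-spec : ∀ n {lam} → lam ∈ partitions n → Positive lam × sum lam ≡ n
partitions-spec n lam∈ = compositions-spec n (proj₁ (∈-filter⁻ (linked? ℕ._≥?_) lam∈))

Cs≡ι*Cs/k : ∀ n {lam} → lam ∈ partitions (suc n) → ∀ k → Cs lam k ≡ ι k * Cs/k lam k
Cs≡ι*Cs/k n lam∈ k with partitions-spec (suc n) lam∈
... | _∷_ r {lam} _ , _ = trans (cong (_* Cs lam k) (C≡ι*C/k r k)) (ℚ.*-assoc (ι k) (C/k r k) (Cs lam k))

-- This is the divisibility by k²: after division by k, a second part s + 1 still contributes the
-- factor C(0 , s + 1) = 0. A single part is fixed by the sum.
Cs/k-at-0 : ∀ n {lam} → lam ∈ partitions (suc n) → lam ≡ suc n ∷ [] ⊎ Cs/k lam 0 ≡ 0ℚ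
Cs/k-at-0 n lam∈ with partitions-spec (suc n) lam∈
... | (r ∷ []) , eq = inj₁ (cong (_∷ []) (trans (sym (ℕ.+-identityʳ (suc r))) eq))
... | _∷_ r (_∷_ s {lam} _) , eq = inj₂ (trans (cong (C/k r 0 *_) (ℚ.*-zeroˡ (Cs lam 0))) (ℚ.*-zeroʳ (C/k r 0)))

-- Nonnegative sums and coefficients of expansions

sumOver-cong∈ : ∀ (xs : List A) {f g : A → ℚ} → (∀ {x} → x ∈ xs → f x ≡ g x) → sumOver xs f ≡ sumOver xs g
sumOver-cong∈ []       f≗g = refl
sumOver-cong∈ (x ∷ xs) f≗g = cong₂ _+_ (f≗g (here refl)) (sumOver-cong∈ xs (f≗g ∘ there))

sumOver-nonneg : ∀ (xs : List A) {f : A → ℚ} → (∀ {x} → x ∈ xs → 0ℚ ≤ f x) → 0ℚ ≤ sumOver xs f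
sumOver-nonneg []       f≥0 = ℚ.≤-refl
sumOver-nonneg (x ∷ xs) f≥0 = ℚ.+-mono-≤ (f≥0 (here refl)) (sumOver-nonneg xs (f≥0 ∘ there))

+-zeroˡ⁻ : ∀ {p q} → 0ℚ ≤ p → 0ℚ ≤ q → p + q ≡ 0ℚ → p ≡ 0ℚ
+-zeroˡ⁻ {p} {q} 0≤p 0≤q eq = ℚ.≤-antisym
  (ℚ.≤-trans (ℚ.≤-reflexive (sym (ℚ.+-identityʳ p))) (ℚ.≤-trans (ℚ.+-monoʳ-≤ p 0≤q) (ℚ.≤-reflexive eq))) 0≤p

sumOver-zero⁻ : ∀ (xs : List A) {f : A → ℚ} → (∀ {x} → x ∈ xs → 0ℚ ≤ f x) →
  sumOver xs f ≡ 0ℚ → ∀ {x} → x ∈ xs → f x ≡ 0ℚ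
sumOver-zero⁻ (x ∷ xs) f≥0 eq (here refl) = +-zeroˡ⁻ (f≥0 (here refl)) (sumOver-nonneg xs (f≥0 ∘ there)) eq
sumOver-zero⁻ (x ∷ xs) {f} f≥0 eq (there x∈) = sumOver-zero⁻ xs (f≥0 ∘ there)
  (+-zeroˡ⁻ (sumOver-nonneg xs (f≥0 ∘ there)) (f≥0 (here refl)) (trans (ℚ.+-comm _ (f x)) eq)) x∈

total-expansion : ∀ {F} (E : EExpansion n F) k →
  HasTotal k (F k) (sumOver (partitions n) (λ lam → coeff E lam * Cs lam k))
total-expansion {n} E k = total-cong k (λ α → sym (expands E k α))
  (total-sumOver k (partitions n) (λ lam → total-*ˡ k (coeff E lam) (total-e[] k lam)))

_^_ : ℚ → ℕ → ℚ
q ^ zero  = 1ℚ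
q ^ suc m = q * q ^ m

poly-^ : ∀ {f} m → Polynomial f → Polynomial (λ k → f k ^ m)
poly-^ zero    F = poly-const 1ℚ
poly-^ (suc m) F = poly-* F (poly-^ m F)

^-≢0 : ∀ {q} m → q ≢ 0ℚ → q ^ m ≢ 0ℚ
^-≢0 zero    q≢0 = ℚ.1≢0
^-≢0 {q} (suc m) q≢0 eq = ^-≢0 m q≢0 (*-cancelˡ q≢0 (trans eq (sym (ℚ.*-zeroʳ q))))

-- The linear terms in k are compared through the values at 0 of the quotients by k.
top-coefficient : ∀ m {F} (E : EExpansion (suc m) F) →
  (∀ k → HasTotal (suc k) (F (suc k)) (ι (suc k) * (ι (suc k) - 1ℚ) ^ m)) →
  coeff E (suc m ∷ []) * sumOver (partitions (suc m)) (λ lam → Cs/k lam 0) ≡ (0ℚ - 1ℚ) ^ m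
top-coefficient m {F} E tot = begin
  c (suc m ∷ []) * sumOver P (λ lam → Cs/k lam 0)    ≡⟨ sumOver-*ˡ P (c (suc m ∷ [])) (λ lam → Cs/k lam 0) ⟨
  sumOver P (λ lam → c (suc m ∷ []) * Cs/k lam 0)    ≡⟨ sumOver-cong∈ P simple ⟩
  left 0                                          ≡⟨ solve 2 (λ x y → x := (x :- y) :+ y) refl (left 0) (right 0) ⟩
  (left 0 - right 0) + right 0                    ≡⟨ cong (_+ right 0) (poly-vanish poly agree) ⟩
  0ℚ + right 0                                    ≡⟨ ℚ.+-identityˡ (right 0) ⟩
  right 0                                         ∎
  where
  open ≡-Reasoning
  c = coeff E
  P = partitions (suc m)
  left right : ℕ → ℚ
  -- Both functions are quotients by k: `left` of the specialised expansion, `right` of k (k - 1)^m.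
  -- Their values at 0 are the linear coefficients.
  left k  = sumOver P (λ lam → c lam * Cs/k lam k)
  right k = (ι k - 1ℚ) ^ m
  -- All terms other than the one for (m + 1) vanish, so every coefficient may be replaced by that
  -- of (m + 1) and pulled out; the remaining sum stays unevaluated.
  simple : ∀ {lam} → lam ∈ P → c (suc m ∷ []) * Cs/k lam 0 ≡ c lam * Cs/k lam 0
  simple {lam} lam∈ with Cs/k-at-0 m lam∈
  ... | inj₁ refl = refl
  ... | inj₂ top≡0  = trans (cong (c (suc m ∷ []) *_) top≡0) (trans (ℚ.*-zeroʳ (c (suc m ∷ [])))
    (sym (trans (cong (c lam *_) top≡0) (ℚ.*-zeroʳ (c lam)))))
  poly : Polynomial (λ k → left k - right k)
  poly = poly-minus (poly-sumOver P (λ lam → poly-* (poly-const (c lam)) (Cs/k-poly lam)))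
    (poly-^ m (poly-minus poly-ι (poly-const 1ℚ)))
  -- The totals speak about multiples of the number of variables; at k + 1 that factor is nonzero
  -- and cancels.
  scaled : ∀ k → ι (suc k) * left (suc k) ≡ ι (suc k) * right (suc k)
  scaled k = begin
    ι (suc k) * left (suc k)
      ≡⟨ sumOver-*ˡ P (ι (suc k)) (λ lam → c lam * Cs/k lam (suc k)) ⟨
    sumOver P (λ lam → ι (suc k) * (c lam * Cs/k lam (suc k)))
      ≡⟨ sumOver-cong∈ P (λ {lam} lam∈ → trans
           (solve 3 (λ x y z → x :* (y :* z) := y :* (x :* z)) refl (ι (suc k)) (c lam) (Cs/k lam (suc k)))
           (cong (c lam *_) (sym (Cs≡ι*Cs/k m lam∈ (suc k))))) ⟩
    sumOver P (λ lam → c lam * Cs lam (suc k))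
      ≡⟨ total-unique (suc k) {F (suc k)} (λ _ → refl) (total-expansion E (suc k)) (tot k) ⟩
    ι (suc k) * right (suc k) ∎
  agree : ∀ k → left (suc k) - right (suc k) ≡ 0ℚ
  agree k = trans (cong (_- right (suc k)) (*-cancelˡ (0<⇒≢0 (ι-pos k)) (scaled k))) (ℚ.+-inverseʳ (right (suc k)))


-- Colorings

𝟙-× : ∀ {P R : Set} (P? : Dec P) (R? : Dec R) → 𝟙 (P? ×-dec R?) ≡ 𝟙 P? * 𝟙 R?
𝟙-× P? R? with does P?
... | true  = sym (ℚ.*-identityˡ (𝟙 R?))
... | false = sym (ℚ.*-zeroˡ (𝟙 R?))

𝟙-¬ : ∀ {P : Set} (P? : Dec P) → 𝟙 (¬? P?) ≡ 1ℚ + (- 1ℚ) * 𝟙 P?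
𝟙-¬ P? with does P?
... | true  = refl
... | false = refl

𝟙-⇔ : ∀ {P R : Set} (P? : Dec P) (R? : Dec R) → P ⇔ R → 𝟙 P? ≡ 𝟙 R?
𝟙-⇔ P? R? P⇔R = cong (λ b → if b then 1ℚ else 0ℚ) (does-⇔ P⇔R P? R?)

sumOver-allFin : ∀ k (f : Fin (suc k) → ℚ) → sumOver (allFin (suc k)) f ≡ f zero + sumOver (allFin k) (f ∘ suc)
sumOver-allFin k f = cong (λ xs → f zero + ∑ xs)
  (trans (List.map-tabulate suc f) (sym (List.map-tabulate id (f ∘ suc))))

sumOver-allFin-const : ∀ k q → sumOver (allFin k) (λ _ → q) ≡ ι k * q
sumOver-allFin-const zero    q = sym (ℚ.*-zeroˡ q)
sumOver-allFin-const (suc k) q = trans (sumOver-allFin k (λ _ → q)) (trans (cong (q +_) (sumOver-allFin-const k q))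
  (solve 2 (λ x q → q :+ x :* q := (con 1ℚ :+ x) :* q) refl (ι k) q))

sumOver-allFin-≟ : ∀ k (b : Fin k) → sumOver (allFin k) (λ c → 𝟙 (c Fin.≟ b)) ≡ 1ℚ
sumOver-allFin-≟ (suc k) zero    = trans (sumOver-allFin k (λ c → 𝟙 (c Fin.≟ zero)))
  (cong (1ℚ +_) (sumOver-0 (allFin k)))
sumOver-allFin-≟ (suc k) (suc b) = trans (sumOver-allFin k (λ c → 𝟙 (c Fin.≟ suc b)))
  (trans (ℚ.+-identityˡ _) (sumOver-allFin-≟ k b))

sumOver-allFin-≢ : ∀ k (b : Fin k) → sumOver (allFin k) (λ c → 𝟙 (¬? (c Fin.≟ b))) ≡ ι k - 1ℚ
sumOver-allFin-≢ k b = begin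
  sumOver (allFin k) (λ c → 𝟙 (¬? (c Fin.≟ b)))
    ≡⟨ sumOver-cong (allFin k) (λ c → 𝟙-¬ (c Fin.≟ b)) ⟩
  sumOver (allFin k) (λ c → 1ℚ + (- 1ℚ) * 𝟙 (c Fin.≟ b))
    ≡⟨ sumOver-+ (allFin k) (λ _ → 1ℚ) (λ c → (- 1ℚ) * 𝟙 (c Fin.≟ b)) ⟩
  sumOver (allFin k) (λ _ → 1ℚ) + sumOver (allFin k) (λ c → (- 1ℚ) * 𝟙 (c Fin.≟ b))
    ≡⟨ cong₂ _+_ (trans (sumOver-allFin-const k 1ℚ) (ℚ.*-identityʳ (ι k)))
         (trans (sumOver-*ˡ (allFin k) (- 1ℚ) (λ c → 𝟙 (c Fin.≟ b))) (cong ((- 1ℚ) *_) (sumOver-allFin-≟ k b))) ⟩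
  ι k - 1ℚ ∎
  where open ≡-Reasoning

sumOver-colorings-suc : ∀ n k (f : Vec (Fin k) (suc n) → ℚ) →
  sumOver (colorings (suc n) k) f ≡ sumOver (allFin k) (λ c → sumOver (colorings n k) (λ κ → f (c ∷ κ)))
sumOver-colorings-suc n k = sumOver-cartesianProductWith _∷_ (allFin k) (colorings n k)

sumOver-colorings-const : ∀ n k → sumOver (colorings n k) (λ _ → 1ℚ) ≡ ι k ^ n
sumOver-colorings-const zero    k = refl
sumOver-colorings-const (suc n) k = trans (sumOver-colorings-suc n k (λ _ → 1ℚ))
  (trans (sumOver-allFin-const k _) (cong (ι k *_) (sumOver-colorings-const n k)))

-- Overwriting the color of v forgets the old one, so each coloring arises from k pairs of a
-- coloring and a new color.
sumOver-recolor : ∀ {n k} (v : Fin n) (f : Vec (Fin k) n → ℚ) →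
  ι k * sumOver (colorings n k) f ≡ sumOver (colorings n k) (λ κ → sumOver (allFin k) (λ c → f (κ [ v ]≔ c)))
sumOver-recolor {suc n} {k} zero f = begin
  ι k * sumOver (colorings (suc n) k) f
    ≡⟨ cong (ι k *_) (sumOver-colorings-suc n k f) ⟩
  ι k * sumOver (allFin k) (λ c → sumOver (colorings n k) (λ κ → f (c ∷ κ)))
    ≡⟨ cong (ι k *_) (sumOver-swap (allFin k) (colorings n k) (λ c κ → f (c ∷ κ))) ⟩
  ι k * sumOver (colorings n k) (λ κ → sumOver (allFin k) (λ c → f (c ∷ κ)))
    ≡⟨ sumOver-allFin-const k _ ⟨
  sumOver (allFin k) (λ _ → sumOver (colorings n k) (λ κ → sumOver (allFin k) (λ c → f (c ∷ κ))))
    ≡⟨ sumOver-colorings-suc n k (λ κ → sumOver (allFin k) (λ c → f (κ [ zero ]≔ c))) ⟨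
  sumOver (colorings (suc n) k) (λ κ → sumOver (allFin k) (λ c → f (κ [ zero ]≔ c))) ∎
  where open ≡-Reasoning
sumOver-recolor {suc n} {k} (suc v) f = begin
  ι k * sumOver (colorings (suc n) k) f
    ≡⟨ cong (ι k *_) (sumOver-colorings-suc n k f) ⟩
  ι k * sumOver (allFin k) (λ c → sumOver (colorings n k) (λ κ → f (c ∷ κ)))
    ≡⟨ sumOver-*ˡ (allFin k) (ι k) (λ c → sumOver (colorings n k) (λ κ → f (c ∷ κ))) ⟨
  sumOver (allFin k) (λ c → ι k * sumOver (colorings n k) (λ κ → f (c ∷ κ)))
    ≡⟨ sumOver-cong (allFin k) (λ c → sumOver-recolor v (λ κ → f (c ∷ κ))) ⟩
  sumOver (allFin k) (λ c → sumOver (colorings n k) (λ κ → sumOver (allFin k) (λ c′ → f (c ∷ κ [ v ]≔ c′))))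
    ≡⟨ sumOver-colorings-suc n k (λ κ → sumOver (allFin k) (λ c → f (κ [ suc v ]≔ c))) ⟨
  sumOver (colorings (suc n) k) (λ κ → sumOver (allFin k) (λ c → f (κ [ suc v ]≔ c))) ∎
  where open ≡-Reasoning

-- Each proper coloring contributes just the monomial of its content, a series of total 1.
total-X : ∀ {n} (G : Graph n) k →
  HasTotal k (X G k) (sumOver (colorings n k) (λ κ → 𝟙 (proper? G κ)))
total-X {n} G k = subst (HasTotal k (X G k)) (sumOver-cong (colorings n k) (λ κ → ℚ.*-identityʳ (𝟙 (proper? G κ))))
  (total-cong k unfold
    (total-sumOver k (colorings n k) (λ κ → total-*ˡ k (𝟙 (proper? G κ)) (total-singleton k (content κ)))))
  where
  unfold : ∀ α → sumOver (colorings n k) (λ κ → 𝟙 (proper? G κ) * 𝟙 (Vec.≡-dec ℕ._≟_ (content κ) α)) ≡ X G k α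
  unfold α = sym (trans (length-filter (λ κ → proper? G κ ×-dec Vec.≡-dec ℕ._≟_ (content κ) α) (colorings n k))
    (sumOver-cong (colorings n k) (λ κ → 𝟙-× (proper? G κ) (Vec.≡-dec ℕ._≟_ (content κ) α))))

-- Trees

In : Subset n → Fin n → Set
In S v = lookup S v ≡ true

∣insert∣ : ∀ (S : Subset n) v → lookup S v ≡ false → ∣ S [ v ]≔ true ∣ ≡ suc ∣ S ∣
∣insert∣ (false ∷ S) zero    _   = refl
∣insert∣ (false ∷ S) (suc v) v∉S = ∣insert∣ S v v∉S
∣insert∣ (true  ∷ S) (suc v) v∉S = cong suc (∣insert∣ S v v∉S)

missing : ∀ (S : Subset n) → ∣ S ∣ ℕ.< n → ∃[ u ] lookup S u ≡ false
missing (false ∷ S) _           = zero , refl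
missing (true  ∷ S) (ℕ.s≤s S<n) = let u , u∉S = missing S S<n in suc u , u∉S

In-full : ∀ (S : Subset n) → ∣ S ∣ ≡ n → ∀ u → In S u
In-full S ∣S∣≡n u rewrite Subset.∣p∣≡n⇒p≡⊤ {p = S} ∣S∣≡n = Vec.lookup-replicate u true

In-insert : ∀ (S : Subset n) v → In (S [ v ]≔ true) v
In-insert S v = Vec.lookup∘update v S true

insert-⊇ : ∀ (S : Subset n) v {u} → In S u → In (S [ v ]≔ true) u
insert-⊇ S v {u} u∈S with u Fin.≟ v
... | yes refl = In-insert S v
... | no u≢v   = trans (Vec.lookup∘update′ u≢v S true) u∈S

In-insert⁻ : ∀ (S : Subset n) v {u} → In (S [ v ]≔ true) u → u ≡ v ⊎ In S u
In-insert⁻ S v {u} u∈ with u Fin.≟ v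
... | yes u≡v = inj₁ u≡v
... | no u≢v  = inj₂ (trans (sym (Vec.lookup∘update′ u≢v S true)) u∈)

In-≢ : ∀ (S : Subset n) {u v} → lookup S v ≡ false → In S u → u ≢ v
In-≢ S v∉S u∈S refl = contradiction (trans (sym v∉S) u∈S) λ ()

module _ {n : ℕ} (G : Graph n) where

  -- Indexed by `Fin` like `Cycle`, so that a path on at least three vertices with adjacent ends
  -- supplies the fields of a cycle directly.
  record Path (S : Subset n) (p q : Fin n) : Set where
    field
      {m}      : ℕ
      at       : Fin (suc m) → Fin n
      distinct : Injective _≡_ _≡_ at
      start    : at zero ≡ p
      end      : at (fromℕ m) ≡ q
      inside   : ∀ i → In S (at i)
      step     : ∀ i → Adj G (at (inject₁ i)) (at (suc i))

  trivial : ∀ {S p} → In S p → Path S p p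
  trivial {p = p} p∈S = record
    { m = 0 ; at = λ _ → p ; distinct = λ { {zero} {zero} _ → refl } ; start = refl ; end = refl
    ; inside = λ _ → p∈S ; step = λ () }

  cons : ∀ {S p q v} → lookup S v ≡ false → Adj G v p → Path S p q → Path (S [ v ]≔ true) v q
  cons {S} {p} {q} {v} v∉S v~p P = record
    { at = at′ ; distinct = distinct′ ; start = refl ; end = end ; inside = inside′ ; step = step′ }
    where
    open Path P
    at′ : Fin (suc (suc m)) → Fin n
    at′ zero    = v
    at′ (suc i) = at i
    distinct′ : Injective _≡_ _≡_ at′
    distinct′ {zero}  {zero}  _  = refl
    distinct′ {zero}  {suc j} eq = contradiction (sym eq) (In-≢ S v∉S (inside j))
    distinct′ {suc i} {zero}  eq = contradiction eq (In-≢ S v∉S (inside i))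
    distinct′ {suc i} {suc j} eq = cong suc (distinct eq)
    inside′ : ∀ i → In (S [ v ]≔ true) (at′ i)
    inside′ zero    = In-insert S v
    inside′ (suc i) = insert-⊇ S v (inside i)
    step′ : ∀ i → Adj G (at′ (inject₁ i)) (at′ (suc i))
    step′ zero    = subst (Adj G v) (sym start) v~p
    step′ (suc i) = step i

  opposite-inject₁ : ∀ {m} (i : Fin m) → opposite (inject₁ i) ≡ suc (opposite i)
  opposite-inject₁ zero    = refl
  opposite-inject₁ (suc i) = cong inject₁ (opposite-inject₁ i)

  opposite-fromℕ : ∀ m → opposite (fromℕ m) ≡ zero
  opposite-fromℕ zero    = refl
  opposite-fromℕ (suc m) = cong inject₁ (opposite-fromℕ m)

  reverse : ∀ {S p q} → Path S p q → Path S q p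
  reverse P = record
    { at       = at ∘ opposite
    ; distinct = λ {i} {j} eq → trans (sym (Fin.opposite-involutive i))
        (trans (cong opposite (distinct eq)) (Fin.opposite-involutive j))
    ; start    = end
    ; end      = trans (cong at (opposite-fromℕ m)) start
    ; inside   = inside ∘ opposite
    ; step     = λ i → subst (λ j → Adj G (at j) (at (inject₁ (opposite i)))) (sym (opposite-inject₁ i))
        (Graph.sym G (step (opposite i)))
    }
    where open Path P

  widen : ∀ {S p q} v → Path S p q → Path (S [ v ]≔ true) p q
  widen {S} v P = record
    { at = at ; distinct = distinct ; start = start ; end = end ; inside = insert-⊇ S v ∘ inside ; step = step }
    where open Path P

  -- Put v in front of the path from p to q and close up with the edge between q and v. Since p ≢ q,
  -- the path has an edge, so at least three vertices occur.
  cycle : ∀ {S p q v} → lookup S v ≡ false → Adj G v p → Adj G v q → p ≢ q → Path S p q → Cycle G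
  cycle v∉S v~p v~q p≢q record { m = zero ; start = start ; end = end } =
    contradiction (trans (sym start) end) p≢q
  cycle {v = v} v∉S v~p v~q p≢q P@record { m = suc m } = record
    { c = at ; distinct = distinct ; step = step ; close = subst (λ u → Adj G u v) (sym end) (Graph.sym G v~q) }
    where open Path (cons v∉S v~p P)

  PathConnected : Subset n → Set
  PathConnected S = ∀ {p q} → In S p → In S q → Path S p q

  insert-connected : ∀ {S p v} → lookup S v ≡ false → In S p → Adj G v p →
    PathConnected S → PathConnected (S [ v ]≔ true)
  insert-connected {S} {p} {v} v∉S p∈S v~p conn a∈ b∈ with In-insert⁻ S v a∈ | In-insert⁻ S v b∈
  ... | inj₁ refl | inj₁ refl = trivial a∈
  ... | inj₁ refl | inj₂ b∈S  = cons v∉S v~p (conn p∈S b∈S)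
  ... | inj₂ a∈S  | inj₁ refl = reverse (cons v∉S v~p (conn p∈S a∈S))
  ... | inj₂ a∈S  | inj₂ b∈S  = widen v (conn a∈S b∈S)

  -- Proper colorings of induced subgraphs

  ProperOn : ∀ {k} → Subset n → Vec (Fin k) n → Set
  ProperOn S κ = ∀ u w → In S u → In S w → Adj G u w → lookup κ u ≢ lookup κ w

  properOn? : ∀ {k} S (κ : Vec (Fin k) n) → Dec (ProperOn S κ)
  properOn? S κ = Fin.all? λ u → Fin.all? λ w → (lookup S u Bool.≟ true) →-dec ((lookup S w Bool.≟ true) →-dec
    (adj? G u w →-dec ¬? (lookup κ u Fin.≟ lookup κ w)))

  -- Vertices outside S are colored freely, so that S need not be relabelled.
  properCount : ℕ → Subset n → ℚ
  properCount k S = sumOver (colorings n k) (λ κ → 𝟙 (properOn? S κ))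

  module _ {S : Subset n} {p v : Fin n} (v∉S : lookup S v ≡ false) (p∈S : In S p)
           (v~p : Adj G v p) (only : ∀ {q} → In S q → Adj G v q → q ≡ p) where

    -- By `only`, the edge to p is the sole edge between v and S, so v adds a single constraint;
    -- those inside S do not see the color of v.
    properOn-insert : ∀ {k} (κ : Vec (Fin k) n) c →
      ProperOn (S [ v ]≔ true) (κ [ v ]≔ c) ⇔ (ProperOn S κ × c ≢ lookup κ p)
    properOn-insert κ c = mk⇔ to from
      where
      new : lookup (κ [ v ]≔ c) v ≡ c
      new = Vec.lookup∘update v κ c
      old : ∀ {u} → In S u → lookup (κ [ v ]≔ c) u ≡ lookup κ u
      old u∈S = Vec.lookup∘update′ (In-≢ S v∉S u∈S) κ c
      to : ProperOn (S [ v ]≔ true) (κ [ v ]≔ c) → ProperOn S κ × c ≢ lookup κ p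
      to proper =
        (λ u w u∈S w∈S u~w eq → proper u w (insert-⊇ S v u∈S) (insert-⊇ S v w∈S) u~w
          (trans (old u∈S) (trans eq (sym (old w∈S))))) ,
        (λ eq → proper v p (In-insert S v) (insert-⊇ S v p∈S) v~p (trans new (trans eq (sym (old p∈S)))))
      from : ProperOn S κ × c ≢ lookup κ p → ProperOn (S [ v ]≔ true) (κ [ v ]≔ c)
      from (proper , c≢) u w u∈ w∈ u~w eq with In-insert⁻ S v u∈ | In-insert⁻ S v w∈
      ... | inj₁ refl | inj₁ refl = irrefl G v u~w
      ... | inj₁ refl | inj₂ w∈S  with refl ← only w∈S u~w = c≢ (trans (sym new) (trans eq (old w∈S)))
      ... | inj₂ u∈S  | inj₁ refl with refl ← only u∈S (Graph.sym G u~w) =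
        c≢ (trans (sym new) (trans (sym eq) (old u∈S)))
      ... | inj₂ u∈S  | inj₂ w∈S  = proper u w u∈S w∈S u~w (trans (sym (old u∈S)) (trans eq (old w∈S)))

    -- Recoloring v: a coloring proper on S excludes just one color at v, that of p.
    properCount-insert : ∀ k → ι k * properCount k (S [ v ]≔ true) ≡ (ι k - 1ℚ) * properCount k S
    properCount-insert k = begin
      ι k * properCount k (S [ v ]≔ true)
        ≡⟨ sumOver-recolor v (λ κ → 𝟙 (properOn? (S [ v ]≔ true) κ)) ⟩
      sumOver (colorings n k) (λ κ → sumOver (allFin k) (λ c → 𝟙 (properOn? (S [ v ]≔ true) (κ [ v ]≔ c))))
        ≡⟨ sumOver-cong (colorings n k) (λ κ → trans
             (sumOver-cong (allFin k) (λ c → trans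
               (𝟙-⇔ (properOn? (S [ v ]≔ true) (κ [ v ]≔ c)) (properOn? S κ ×-dec ¬? (c Fin.≟ lookup κ p)) (properOn-insert κ c))
               (𝟙-× (properOn? S κ) (¬? (c Fin.≟ lookup κ p)))))
             (trans (sumOver-*ˡ (allFin k) (𝟙 (properOn? S κ)) (λ c → 𝟙 (¬? (c Fin.≟ lookup κ p))))
               (cong (𝟙 (properOn? S κ) *_) (sumOver-allFin-≢ k (lookup κ p))))) ⟩
      sumOver (colorings n k) (λ κ → 𝟙 (properOn? S κ) * (ι k - 1ℚ))
        ≡⟨ sumOver-*ʳ (colorings n k) (ι k - 1ℚ) (λ κ → 𝟙 (properOn? S κ)) ⟩
      properCount k S * (ι k - 1ℚ)
        ≡⟨ ℚ.*-comm (properCount k S) (ι k - 1ℚ) ⟩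
      (ι k - 1ℚ) * properCount k S ∎
      where open ≡-Reasoning

  -- Growing a subtree vertex by vertex

  crossing : ∀ (S : Subset n) {a b} → Star (Adj G) a b → In S a → lookup S b ≡ false →
    ∃[ p ] ∃[ v ] In S p × lookup S v ≡ false × Adj G v p
  crossing S ε a∈S a∉S = contradiction (trans (sym a∉S) a∈S) λ ()
  crossing S {a} (_◅_ {j = x} a~x walk) a∈S b∉S with lookup S x in eq
  ... | true  = crossing S walk eq b∉S
  ... | false = a , x , a∈S , eq , Graph.sym G a~x

  -- S spans a subtree with j edges and n - j - 1 vertices remain free, so for j < n the count
  -- should be k^(n - j) (k - 1)^j. Multiplying by k^j avoids truncated subtraction and fits the
  -- factor k of recoloring.
  record Grown (j : ℕ) : Set where
    field
      S         : Subset n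
      size      : ∣ S ∣ ≡ suc j
      root      : Fin n
      root∈S    : In S root
      joined    : PathConnected S
      counted   : ∀ k → ι k ^ j * properCount k S ≡ (ι k - 1ℚ) ^ j * ι k ^ n

  module _ (tree : IsTree G) where

    grow-root : Grown 0
    grow-root = record
      { S = ⁅r⁆ ; size = size ; root = r ; root∈S = In-insert ∅ r ; joined = conn ; counted = counted }
      where
      r = Connected.vertex (proj₁ tree)
      ∅ ⁅r⁆ : Subset n
      ∅   = replicate n false
      ⁅r⁆ = ∅ [ r ]≔ true
      size : ∣ ⁅r⁆ ∣ ≡ 1
      size = trans (∣insert∣ ∅ r (Vec.lookup-replicate r false)) (cong suc (Subset.∣⊥∣≡0 n))
      only-r : ∀ {u} → In ⁅r⁆ u → u ≡ r
      only-r {u} u∈ with In-insert⁻ ∅ r u∈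
      ... | inj₁ u≡r = u≡r
      ... | inj₂ u∈∅ = contradiction (trans (sym (Vec.lookup-replicate u false)) u∈∅) λ ()
      conn : PathConnected ⁅r⁆
      conn p∈ q∈ with refl ← only-r p∈ | refl ← only-r q∈ = trivial p∈
      all-proper : ∀ {k} (κ : Vec (Fin k) n) → ProperOn ⁅r⁆ κ
      all-proper κ u w u∈ w∈ u~w with refl ← only-r u∈ | refl ← only-r w∈ = contradiction u~w (irrefl G r)
      counted : ∀ k → 1ℚ * properCount k ⁅r⁆ ≡ 1ℚ * ι k ^ n
      counted k = cong (1ℚ *_) (trans
        (sumOver-cong (colorings n k) (λ κ → cong (λ b → if b then 1ℚ else 0ℚ) (dec-true (properOn? ⁅r⁆ κ) (all-proper κ))))
        (sumOver-colorings-const n k))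

    -- A walk from the root to a missing vertex leaves S along an edge from some p to some v.
    -- Another neighbour q of v in S would give a cycle with the path from q to p supplied by
    -- `joined`.
    grow-step : ∀ {j} → suc j ℕ.< n → Grown j → Grown (suc j)
    grow-step {j} j<n grown
      with u , u∉S ← missing (Grown.S grown) (subst (ℕ._< n) (sym (Grown.size grown)) j<n)
      with p , v , p∈S , v∉S , v~p ←
        crossing (Grown.S grown) (Connected.walk (proj₁ tree) (Grown.root grown) u) (Grown.root∈S grown) u∉S
      = record
      { S         = S [ v ]≔ true
      ; size      = trans (∣insert∣ S v v∉S) (cong suc size)
      ; root      = root
      ; root∈S    = insert-⊇ S v root∈S
      ; joined    = insert-connected v∉S p∈S v~p joined
      ; counted   = counted′
      }
      where
      open Grown grown
      only : ∀ {q} → In S q → Adj G v q → q ≡ p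
      only {q} q∈S v~q with q Fin.≟ p
      ... | yes q≡p = q≡p
      ... | no q≢p  = contradiction (cycle v∉S v~q v~p q≢p (joined q∈S p∈S)) (proj₂ tree)
      counted′ : ∀ k → ι k ^ suc j * properCount k (S [ v ]≔ true) ≡ (ι k - 1ℚ) ^ suc j * ι k ^ n
      counted′ k = begin
        ι k * ι k ^ j * properCount k (S [ v ]≔ true)
          ≡⟨ solve 3 (λ x y z → x :* y :* z := y :* (x :* z)) refl (ι k) (ι k ^ j) (properCount k (S [ v ]≔ true)) ⟩
        ι k ^ j * (ι k * properCount k (S [ v ]≔ true))
          ≡⟨ cong (ι k ^ j *_) (properCount-insert {S = S} v∉S p∈S v~p only k) ⟩
        ι k ^ j * ((ι k - 1ℚ) * properCount k S)
          ≡⟨ solve 3 (λ x y z → x :* (y :* z) := y :* (x :* z)) refl (ι k ^ j) (ι k - 1ℚ) (properCount k S) ⟩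
        (ι k - 1ℚ) * (ι k ^ j * properCount k S)
          ≡⟨ cong ((ι k - 1ℚ) *_) (counted k) ⟩
        (ι k - 1ℚ) * ((ι k - 1ℚ) ^ j * ι k ^ n)
          ≡⟨ ℚ.*-assoc (ι k - 1ℚ) ((ι k - 1ℚ) ^ j) (ι k ^ n) ⟨
        (ι k - 1ℚ) * (ι k - 1ℚ) ^ j * ι k ^ n ∎
        where open ≡-Reasoning

    grow : ∀ j → j ℕ.< n → Grown j
    grow zero    _   = grow-root
    grow (suc j) j<n = grow-step j<n (grow j (ℕ.<⇒≤ j<n))

-- After m steps S contains all vertices. The number of variables is a successor because the factor
-- k^m in `counted` has to be cancelled.
total-tree : ∀ m (G : Graph (suc m)) → IsTree G → ∀ k →
  HasTotal (suc k) (X G (suc k)) (ι (suc k) * (ι (suc k) - 1ℚ) ^ m)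
total-tree m G tree k = subst (HasTotal (suc k) (X G (suc k))) count (total-X G (suc k))
  where
  open Grown (grow G tree m (ℕ.n<1+n m))
  open ≡-Reasoning
  x = ι (suc k)
  everything : ∀ u → In S u
  everything = In-full S size
  count : sumOver (colorings (suc m) (suc k)) (λ κ → 𝟙 (proper? G κ)) ≡ x * (x - 1ℚ) ^ m
  count = *-cancelˡ (^-≢0 m (0<⇒≢0 (ι-pos k))) (begin
    x ^ m * sumOver (colorings (suc m) (suc k)) (λ κ → 𝟙 (proper? G κ))
      ≡⟨ cong (x ^ m *_) (sumOver-cong (colorings (suc m) (suc k)) (λ κ → 𝟙-⇔ (proper? G κ) (properOn? G S κ)
           (mk⇔ (λ proper u w _ _ → proper u w) (λ proper u w → proper u w (everything u) (everything w))))) ⟩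
    x ^ m * properCount G (suc k) S
      ≡⟨ counted (suc k) ⟩
    (x - 1ℚ) ^ m * (x * x ^ m)
      ≡⟨ solve 3 (λ a b c → a :* (b :* c) := c :* (b :* a)) refl ((x - 1ℚ) ^ m) x (x ^ m) ⟩
    x ^ m * (x * (x - 1ℚ) ^ m) ∎)

-- Comparing two trees

÷₀-self : ∀ {p} → p ≢ 0ℚ → p ÷₀ p ≡ 1ℚ
÷₀-self {p} p≢0 with p ℚ.≟ 0ℚ
... | yes p≡0 = contradiction p≡0 p≢0
... | no  ≢0  = ℚ.*-inverseʳ p {{≢-nonZero ≢0}}

total-⊖ : ∀ k {F G : Series} {s t} → HasTotal k (F k) s → HasTotal k (G k) t → HasTotal k ((F ⊖ 1ℚ • G) k) (s - t)
total-⊖ k {F} {G} {s} {t} S T = subst (HasTotal k ((F ⊖ 1ℚ • G) k)) (minus s t)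
  (total-cong k (λ α → trans (minus (F k α) (G k α)) (cong (λ y → F k α - y) (sym (ℚ.*-identityˡ (G k α)))))
    (total-+ k S (total-*ˡ k (- 1ℚ) T)))
  where
  minus : ∀ x y → x + (- 1ℚ) * y ≡ x - y
  minus x y = solve 2 (λ x y → x :+ con (- 1ℚ) :* y := x :- y) refl x y

⊖-≈ : ∀ {F G : Series} → (∀ k α → (F ⊖ 1ℚ • G) k α ≡ 0ℚ) → F ≈ G
⊖-≈ {F} {G} zeros k α = begin
  F k α                              ≡⟨ solve 2 (λ x y → x := (x :- con 1ℚ :* y) :+ y) refl (F k α) (G k α) ⟩
  (F k α - 1ℚ * G k α) + G k α       ≡⟨ cong (_+ G k α) (zeros k α) ⟩
  0ℚ + G k α                         ≡⟨ ℚ.+-identityˡ (G k α) ⟩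
  G k α                              ∎
  where open ≡-Reasoning

-- One evaluation, in n variables, forces every coefficient to be 0; the expansion then vanishes in
-- any number of variables.
EPositive-total-0 : ∀ n {F} → EPositive n F → HasTotal n (F n) 0ℚ → ∀ k α → F k α ≡ 0ℚ
EPositive-total-0 n {F} (E , E≥0) total k α = trans (expands E k α)
  (trans (sumOver-cong∈ P (λ {lam} lam∈ → trans (cong (_* e[ lam ] k α) (coeff≡0 lam∈)) (ℚ.*-zeroˡ (e[ lam ] k α))))
    (sumOver-0 P))
  where
  open ≡-Reasoning
  P = partitions n
  weight-pos : ∀ {lam} → lam ∈ P → 0ℚ < Cs lam n
  weight-pos {lam} lam∈ = Cs-pos n lam (ℕ.≤-reflexive (proj₂ (partitions-spec n lam∈)))
  coeff≡0 : ∀ {lam} → lam ∈ P → coeff E lam ≡ 0ℚ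
  coeff≡0 {lam} lam∈ = *-cancelˡ (0<⇒≢0 (weight-pos lam∈)) (begin
    Cs lam n * coeff E lam   ≡⟨ ℚ.*-comm (Cs lam n) (coeff E lam) ⟩
    coeff E lam * Cs lam n
      ≡⟨ sumOver-zero⁻ P (λ mu∈ → *-nonneg (All.lookup E≥0 mu∈) (ℚ.<⇒≤ (weight-pos mu∈)))
           (total-unique n {F n} (λ _ → refl) (total-expansion E n) total) lam∈ ⟩
    0ℚ                       ≡⟨ ℚ.*-zeroʳ (Cs lam n) ⟨
    Cs lam n * 0ℚ            ∎)

-- g and h have the same nonzero product (-1)^m with the common factor `simple`. Hence neither that
-- factor nor h is 0, and `simple` can be cancelled.
tree-ratio : ∀ m (G H : Graph (suc m)) → IsTree G → IsTree H →
  (EG : EExpansion (suc m) (X G)) (EH : EExpansion (suc m) (X H)) →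
  coeff EG (suc m ∷ []) ÷₀ coeff EH (suc m ∷ []) ≡ 1ℚ
tree-ratio m G H treeG treeH EG EH = trans (cong (_÷₀ h) g≡h) (÷₀-self h≢0)
  where
  g = coeff EG (suc m ∷ [])
  h = coeff EH (suc m ∷ [])
  simple = sumOver (partitions (suc m)) (λ lam → Cs/k lam 0)
  topG : g * simple ≡ (0ℚ - 1ℚ) ^ m
  topG = top-coefficient m EG (total-tree m G treeG)
  topH : h * simple ≡ (0ℚ - 1ℚ) ^ m
  topH = top-coefficient m EH (total-tree m H treeH)
  -1≢0 : 0ℚ - 1ℚ ≢ 0ℚ
  -1≢0 ()
  simple≢0 : simple ≢ 0ℚ
  simple≢0 eq = ^-≢0 m -1≢0 (trans (sym topG) (trans (cong (g *_) eq) (ℚ.*-zeroʳ g)))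
  h≢0 : h ≢ 0ℚ
  h≢0 eq = ^-≢0 m -1≢0 (trans (sym topH) (trans (cong (_* simple) eq) (ℚ.*-zeroˡ simple)))
  g≡h : g ≡ h
  g≡h = *-cancelˡ simple≢0 (trans (ℚ.*-comm simple g) (trans topG (trans (sym topH) (ℚ.*-comm h simple))))

-- A variable q lets `refl` replace it by 1; the ratio in `Xₑ` is a compound term that could not be
-- matched this way.
EPositive-⊖ : ∀ n (F G : Series) {s q} → HasTotal n (F n) s → HasTotal n (G n) s →
  q ≡ 1ℚ → EPositive n (F ⊖ q • G) → F ≈ G
EPositive-⊖ n F G {s} S T refl pos = ⊖-≈ {F} {G} (EPositive-total-0 n {F ⊖ 1ℚ • G} pos
  (subst (HasTotal n ((F ⊖ 1ℚ • G) n)) (ℚ.+-inverseʳ s) (total-⊖ n {F} {G} S T)))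

≥ₑ⇒∼ : ∀ m (T₁ T₂ : 𝓔 (suc m)) → IsTree (graph T₁) → IsTree (graph T₂) → T₁ ≥ₑ T₂ → T₁ ∼ T₂
≥ₑ⇒∼ m T₁ T₂ tree₁ tree₂ (E₁ , E₂ , pos) = EPositive-⊖ (suc m) (X (graph T₁)) (X (graph T₂))
  (total-tree m (graph T₁) tree₁ m) (total-tree m (graph T₂) tree₂ m)
  (tree-ratio m (graph T₁) (graph T₂) tree₁ tree₂ E₁ E₂) pos

corollary3p8 : ∀ (n : ℕ) (T₁ T₂ : 𝓔 n) → IsTree (graph T₁) → IsTree (graph T₂) →
    ¬ (T₁ ∼ T₂) → ¬ (T₁ ≥ₑ T₂) × ¬ (T₂ ≥ₑ T₁)
corollary3p8 zero    T₁ T₂ tree₁ tree₂ T₁≁T₂ = contradiction (Connected.vertex (connected T₁)) Fin.¬Fin0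
corollary3p8 (suc m) T₁ T₂ tree₁ tree₂ T₁≁T₂ =
  (λ T₁≥T₂ → T₁≁T₂ (≥ₑ⇒∼ m T₁ T₂ tree₁ tree₂ T₁≥T₂)) ,
  (λ T₂≥T₁ → T₁≁T₂ (λ k α → sym (≥ₑ⇒∼ m T₂ T₁ tree₂ tree₁ T₂≥T₁ k α)))
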